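{- Let $G=(V,E,T,\zeta_v,\zeta_e)$ be a dynamic graph and $k$ an integer such that $\operatorname{tw}(G_t)\le k$ for every $t\in T$. Let $\mathcal{G}$ be the Gaifman graph of the treewidth preserving structure $\mathcal{A}(G)$. Then $\operatorname{tw}(\mathcal{G})\le\max\{k+1,|T|-1\}$.
   Context: A dynamic graph $G=(V,E,T,\zeta_v,\zeta_e)$ consists of a finite vertex set $V$, an edge set $E\subset V\times V$ without loops (simple graphs, directed or undirected), a finite set $T=T(G)$ of times, and functions $\zeta_v:V\to 2^T$, $\zeta_e:E\to 2^T$ giving the times at which vertices and edges exist. An edge exists only when both its endpoints do: $\zeta_e(uv)\subseteq\zeta_v(u)\cap\zeta_v(v)$. There is an order relation $<_T$ on $T$, not assumed total or transitive. The snapshot $G_t$ is the static graph with vertices $\{v: t\in\zeta_v(v)\}$ and edges $\{uv: t\in\zeta_e(uv)\}$. $\operatorname{tw}$ denotes treewidth (of the underlying undirected graph). Treewidth preserving structure $\mathcal{A}(G)$: the universe consists of an element $v^t$ for each $v\in V$ and $t\in\zeta_v(v)$, together with an element for each $t\in T$. The vocabulary consists of: $V$ (unary, true of all elements $v^t$); for each $v\in V$ a unary relation $L_v$ (true of the elements $v^t$ generated from $v$); $\Xi$ (ternary, true of $(u^t,v^t,t)$ iff $uv\in E$ and $t\in\zeta_e(uv)$); $T$ (unary, true of the time elements); $R$ (binary, true of $(t_1,t_2)$ iff $t_1,t_2\in T$ and $t_1<_T t_2$). The Gaifman graph of a structure has the universe as vertex set, with two distinct elements adjacent iff they occur together in some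 tuple of some relation of the vocabulary. -}

module Defs where

open import Data.Fin using (Fin)
open import Data.Fin.Subset using (Subset; _∈_; _∉_; _⊆_; _∩_)
open import Data.Integer as ℤ using (ℤ; +_; 1ℤ)
import Data.Integer.Properties as ℤ
open import Data.List using (List; []; _∷_; _∷ʳ_; length; map; allFin)
open import Data.List.Extrema.Nat using (max)
open import Data.List.Membership.Propositional using () renaming (_∈_ to _∈ₗ_)
open import Data.List.Relation.Unary.Linked using (Linked)
open import Data.List.Relation.Unary.Unique.Propositional using (Unique)
open import Data.Nat using (ℕ)
open import Data.Product using (Σ; Σ-syntax; ∃; ∃-syntax; _×_; _,_; proj₁)
open import Data.Sum using (inj₁; inj₂; _⊎_)
import Data.Sum as Sum
open import Data.Vec using (Vec; []; _∷_)
open import Data.Vec.Membership.Propositional using () renaming (_∈_ to _∈ᵥ_)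
open import Function using (_∘_; _⇔_; mk⇔)
open import Level using (0ℓ)
open import Relation.Binary using (Rel; Symmetric; Irreflexive)
open import Relation.Binary.Construct.Closure.ReflexiveTransitive using (Star)
open import Relation.Binary.PropositionalEquality using (_≡_; _≢_; refl; sym)
open import Relation.Nullary using (¬_)
open import Relation.Unary using (Pred)

------------------------------------------------------------------------
-- Static graphs

record Graph (V : Set) : Set₁ where
  field
    _~_      : Rel V 0ℓ
    ~-sym    : Symmetric _~_
    ~-irrefl : Irreflexive _≡_ _~_

record Digraph (V : Set) : Set₁ where
  field
    _⟶_      : Rel V 0ℓ
    ⟶-irrefl : Irreflexive _≡_ _⟶_

underlying : ∀ {V} → Digraph V → Graph V
underlying G = record
  { _~_      = λ u v → u ⟶ v ⊎ v ⟶ u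
  ; ~-sym    = Sum.swap
  ; ~-irrefl = λ { eq (inj₁ e) → ⟶-irrefl eq e
                 ; eq (inj₂ e) → ⟶-irrefl (sym eq) e }
  }
  where open Digraph G

------------------------------------------------------------------------
-- Treewidth

module _ {V : Set} (G : Graph V) where
  open Graph G

  Connected : Set
  Connected = ∀ x y → Star _~_ x y

  -- The cycle through x, y, z, … is listed without repeating x at the end.
  data IsCycle : Pred (List V) 0ℓ where
    isCycle : ∀ {x y z zs} → let c = x ∷ y ∷ z ∷ zs in
              Unique c → Linked _~_ (c ∷ʳ x) → IsCycle c

  Acyclic : Set
  Acyclic = ∀ c → ¬ IsCycle c

  record IsTree : Set where
    field
      someVertex : V
      connected  : Connected
      acyclic    : Acyclic

-- Bags are finite sets of vertices, given as lists without repetitions.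
record TreeDecomposition {V : Set} (G : Graph V) : Set₁ where
  open Graph G
  field
    order  : ℕ
    tree   : Graph (Fin order)
    isTree : IsTree tree
    bag    : Fin order → List V
    unique : ∀ i → Unique (bag i)

  -- Tree adjacency restricted to the nodes whose bag contains v.
  Adjacent∋ : V → Rel (Fin order) 0ℓ
  Adjacent∋ v i j = v ∈ₗ bag i × v ∈ₗ bag j × Graph._~_ tree i j

  field
    coversVertices : ∀ v → ∃[ i ] v ∈ₗ bag i
    coversEdges    : ∀ {u v} → u ~ v → ∃[ i ] (u ∈ₗ bag i × v ∈ₗ bag i)
    connected      : ∀ v {i j} → v ∈ₗ bag i → v ∈ₗ bag j →
                     Star (Adjacent∋ v) i j

  -- Integer valued: the graph without vertices has a decomposition of
  -- width -1.
  width : ℤ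
  width = + max 0 (map (length ∘ bag) (allFin order)) ℤ.- 1ℤ

open TreeDecomposition using (width)

-- w is the treewidth of G: the minimum width of a tree decomposition.
IsTreewidth : ∀ {V} → Graph V → ℤ → Set₁
IsTreewidth G w = (Σ[ D ∈ TreeDecomposition G ] width D ≡ w)
                × (∀ (D : TreeDecomposition G) → w ℤ.≤ width D)

-- A minimum is at most k iff some member is at most k; stating the bound
-- this way avoids computing the minimum, which would need a decision
-- procedure for adjacency.
tw[_]≤_ : ∀ {V} → Graph V → ℤ → Set₁
tw[ G ]≤ k = Σ[ D ∈ TreeDecomposition G ] width D ℤ.≤ k

tw≤⇔treewidth≤ : ∀ {V} {G : Graph V} {w k} → IsTreewidth G w →
                 tw[ G ]≤ k ⇔ w ℤ.≤ k
tw≤⇔treewidth≤ ((D , refl) , least) =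
  mk⇔ (λ (D′ , D′≤k) → ℤ.≤-trans (least D′) D′≤k) (D ,_)

------------------------------------------------------------------------
-- Relational structures

record Vocabulary : Set₁ where
  field
    Symbol : Set
    arity  : Symbol → ℕ

record Structure (σ : Vocabulary) : Set₁ where
  open Vocabulary σ
  field
    Universe : Set
    ⟦_⟧      : ∀ s → Pred (Vec Universe (arity s)) 0ℓ

module _ {σ : Vocabulary} (𝔸 : Structure σ) where
  open Vocabulary σ
  open Structure 𝔸

  CoOccur : Rel Universe 0ℓ
  CoOccur x y = Σ[ s ∈ Symbol ] Σ[ xs ∈ Vec Universe (arity s) ]
                (⟦ s ⟧ xs × x ∈ᵥ xs × y ∈ᵥ xs)

  gaifman : Graph Universe
  gaifman = record
    { _~_      = λ x y → x ≢ y × CoOccur x y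
    ; ~-sym    = λ (x≢y , s , xs , h , x∈ , y∈) →
                   (x≢y ∘ sym) , s , xs , h , y∈ , x∈
    ; ~-irrefl = λ x≡y (x≢y , _) → x≢y x≡y
    }

------------------------------------------------------------------------
-- Dynamic graphs

-- The edge set is given by out-neighbourhoods: uv is an edge iff v ∈ E u.
-- An undirected dynamic graph is one in which E is symmetric and
-- ζₑ (uv) = ζₑ (vu).
record DynamicGraph : Set₁ where
  field
    ∣V∣ ∣T∣ : ℕ

  V : Set
  V = Fin ∣V∣

  T : Set
  T = Fin ∣T∣

  field
    E        : V → Subset ∣V∣
    loopless : ∀ v → v ∉ E v
    ζᵥ       : V → Subset ∣T∣
    ζₑ       : ∀ {u v} → v ∈ E u → Subset ∣T∣
    ζₑ⊆ζᵥ    : ∀ {u v} (uv : v ∈ E u) → ζₑ uv ⊆ ζᵥ u ∩ ζᵥ v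
    _<ₜ_     : Rel T 0ℓ

module _ (G : DynamicGraph) where
  open DynamicGraph G

  snapshot : (t : T) → Digraph (Σ[ v ∈ V ] t ∈ ζᵥ v)
  snapshot t = record
    { _⟶_      = λ (u , _) (v , _) → Σ[ uv ∈ v ∈ E u ] t ∈ ζₑ uv
    ; ⟶-irrefl = λ { {v , _} refl (vv , _) → loopless v vv }
    }

  data 𝒜-Symbol : Set where
    V-sym : 𝒜-Symbol
    L-sym : V → 𝒜-Symbol
    Ξ-sym : 𝒜-Symbol
    T-sym : 𝒜-Symbol
    R-sym : 𝒜-Symbol

  𝒜-vocabulary : Vocabulary
  𝒜-vocabulary = record
    { Symbol = 𝒜-Symbol
    ; arity  = λ { V-sym → 1 ; (L-sym _) → 1 ; Ξ-sym → 3 ; T-sym → 1 ; R-sym → 2 }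
    }

  open Vocabulary 𝒜-vocabulary using (arity)

  data 𝒜-Universe : Set where
    vertex : (v : V) (t : T) → t ∈ ζᵥ v → 𝒜-Universe
    time   : T → 𝒜-Universe

  data 𝒜-Holds : (s : 𝒜-Symbol) → Pred (Vec 𝒜-Universe (arity s)) 0ℓ where
    V-holds : ∀ {v t} (p : t ∈ ζᵥ v) → 𝒜-Holds V-sym (vertex v t p ∷ [])
    L-holds : ∀ {v t} (p : t ∈ ζᵥ v) → 𝒜-Holds (L-sym v) (vertex v t p ∷ [])
    Ξ-holds : ∀ {u v t} (p : t ∈ ζᵥ u) (q : t ∈ ζᵥ v) (uv : v ∈ E u) → t ∈ ζₑ uv →
              𝒜-Holds Ξ-sym (vertex u t p ∷ vertex v t q ∷ time t ∷ [])
    T-holds : ∀ t → 𝒜-Holds T-sym (time t ∷ [])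
    R-holds : ∀ {t₁ t₂} → t₁ <ₜ t₂ → 𝒜-Holds R-sym (time t₁ ∷ time t₂ ∷ [])

  𝒜 : Structure 𝒜-vocabulary
  𝒜 = record { Universe = 𝒜-Universe ; ⟦_⟧ = 𝒜-Holds }

{-# OPTIONS --safe #-}

-- A single bag holding every time element covers the pairs of R, and the
-- pairs of Ξ at time t are covered by a tree decomposition of the snapshot
-- G_t once t is added to each of its bags. Joining the bag of times by one
-- edge to each of these decompositions gives a tree in which the bags
-- containing a given element are still connected.

module Submission where

open import Defs
open import Data.Integer using (ℤ; +_; 1ℤ; _+_; _-_; _⊔_)

open import Data.Empty using (⊥-elim)
open import Data.Fin using (Fin; zero; suc)
open import Data.Fin.Properties using (+↔⊎; 1↔⊤)
open import Data.Fin.Subset using () renaming (_∈_ to _∈ₛ_)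
open import Data.Integer using (_≤_; -1ℤ; +≤+)
import Data.Integer.Properties as ℤ
open import Data.List using (List; []; _∷_; _∷ʳ_; _++_; length; map; allFin)
open import Data.List.Extrema.Nat using (max; argmax-all; xs≤max)
open import Data.List.Membership.Propositional using (_∈_)
open import Data.List.Membership.Propositional.Properties
  using (∈-∃++; ∈-map⁺; ∈-map⁻; ∈-allFin)
open import Data.List.Properties
  using (++-assoc; ++-identityʳ; length-map; length-tabulate; map-++)
open import Data.List.Relation.Binary.Permutation.Propositional using (↭⇒↭ₛ)
open import Data.List.Relation.Binary.Permutation.Propositional.Properties using (++-comm)
import Data.List.Relation.Binary.Permutation.Setoid.Properties as Permutation
open import Data.List.Relation.Unary.All as All using (All; []; _∷_)
import Data.List.Relation.Unary.All.Properties as All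
open import Data.List.Relation.Unary.AllPairs using (_∷_)
open import Data.List.Relation.Unary.Any using (here; there; any?)
open import Data.List.Relation.Unary.Linked as Linked using (Linked; [-]; _∷_)
import Data.List.Relation.Unary.Linked.Properties as Linked
open import Data.List.Relation.Unary.Unique.Propositional using (Unique)
import Data.List.Relation.Unary.Unique.Propositional.Properties as Unique
open import Data.Nat as ℕ using (ℕ; z≤n)
open import Data.Product using (Σ; Σ-syntax; ∃; ∃-syntax; _×_; _,_; proj₁; proj₂)
open import Data.Sum using (_⊎_; inj₁; inj₂)
open import Data.Sum.Function.Propositional using (_⊎-↔_)
open import Data.Unit using (⊤; tt)
open import Data.Vec.Relation.Unary.All as Allᵥ using ([]; _∷_) renaming (All to Allᵥ)
open import Function using (_∘_; _on_; _↔_; mk↔ₛ′; Inverse; Injection)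
open import Function.Construct.Composition using (_↔-∘_)
open import Function.Construct.Identity using (↔-id)
open import Function.Properties.Inverse using (↔⇒↣)
open import Level using (0ℓ)
open import Relation.Binary using (Rel)
open import Relation.Binary.Construct.Closure.ReflexiveTransitive
  using (Star; ε; _◅_; _◅◅_; gmap; reverse)
open import Relation.Binary.PropositionalEquality
  using (_≡_; _≢_; refl; sym; trans; cong; subst; subst₂; setoid)
open import Relation.Nullary using (¬_; Dec; yes; no)

open Inverse using (to; from; strictlyInverseˡ; strictlyInverseʳ)

-- Cycles

module _ {V : Set} {G : Graph V} where
  open Graph G

  Linked-∷ʳ : ∀ xs {x y} → Linked _~_ (xs ∷ʳ x) → x ~ y → Linked _~_ (xs ∷ʳ x ∷ʳ y)
  Linked-∷ʳ []           [-]        x~y = x~y ∷ [-]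
  Linked-∷ʳ (_ ∷ [])     (e ∷ path) x~y = e ∷ Linked-∷ʳ [] path x~y
  Linked-∷ʳ (_ ∷ w ∷ ws) (e ∷ path) x~y = e ∷ Linked-∷ʳ (w ∷ ws) path x~y

  -- On a closed path this finds the neighbour of the start through which the cycle returns.
  penultimate : ∀ {x xs y} → Linked _~_ (x ∷ xs ∷ʳ y) → ∃[ w ] w ∈ x ∷ xs × w ~ y
  penultimate {x} {[]}    (x~y ∷ [-]) = x , here refl , x~y
  penultimate {x} {_ ∷ _} (_ ∷ path) with penultimate path
  ... | w , w∈xs , w~y = w , there w∈xs , w~y

  rotate₁ : ∀ {x xs} → IsCycle G (x ∷ xs) → IsCycle G (xs ∷ʳ x)
  rotate₁ {x} (isCycle distinct path) = go _ distinct path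
    where
    shift : ∀ {xs} → Unique (x ∷ xs) → Unique (xs ∷ʳ x)
    shift {xs} = Permutation.Unique-resp-↭ (setoid V) (↭⇒↭ₛ (++-comm (x ∷ []) xs))

    go : ∀ {y z} zs → Unique (x ∷ y ∷ z ∷ zs) → Linked _~_ (x ∷ y ∷ z ∷ zs ∷ʳ x) →
         IsCycle G (y ∷ z ∷ zs ∷ʳ x)
    -- Splitting on `zs` exposes the third entry of the rotated list, which `isCycle` requires: it
    -- is `x` itself in a triangle and `w` otherwise.
    go []       distinct (x~y ∷ path) = isCycle (shift distinct) (Linked-∷ʳ (_ ∷ _ ∷ []) path x~y)
    go (w ∷ ws) distinct (x~y ∷ path) = isCycle (shift distinct) (Linked-∷ʳ (_ ∷ _ ∷ w ∷ ws) path x~y)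

  -- Iterates `rotate₁` over `xs`, so that a cycle through a given vertex may be assumed to start
  -- there.
  rotate : ∀ xs {ys} → IsCycle G (xs ++ ys) → IsCycle G (ys ++ xs)
  rotate []       {ys} cycle = subst (IsCycle G) (sym (++-identityʳ ys)) cycle
  rotate (x ∷ xs) {ys} cycle =
    subst (IsCycle G) (++-assoc ys (x ∷ []) xs)
      (rotate xs (subst (IsCycle G) (++-assoc xs ys (x ∷ [])) (rotate₁ cycle)))

-- Transport along a bijection

-- A tree decomposition has its nodes in `Fin order`, while the joined tree lives on a sum type;
-- pulling adjacency back along a bijection passes from one to the other.
comap : ∀ {A B : Set} → (A → B) → Graph B → Graph A
comap f G = record
  { _~_      = _~_ on f
  ; ~-sym    = ~-sym
  ; ~-irrefl = ~-irrefl ∘ cong f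
  }
  where open Graph G

module _ {A B : Set} (e : A ↔ B) where

  Star-comap : ∀ {R : Rel B 0ℓ} {x y} → Star R (to e x) (to e y) → Star (R on to e) x y
  Star-comap {R} path =
    subst₂ (Star (R on to e)) (strictlyInverseʳ e _) (strictlyInverseʳ e _)
      (gmap (from e)
            (subst₂ R (sym (strictlyInverseˡ e _)) (sym (strictlyInverseˡ e _))) path)

  comap-isTree : ∀ {G} → IsTree G → IsTree (comap (to e) G)
  comap-isTree {G} G-tree = record
    { someVertex = from e someVertex
    ; connected  = λ x y → Star-comap (connected (to e x) (to e y))
    ; acyclic    = λ c cycle → acyclic (map (to e) c) (cycle⁺ cycle)
    }
    where
    open Graph G
    open IsTree G-tree

    cycle⁺ : ∀ {c} → IsCycle (comap (to e) G) c → IsCycle G (map (to e) c)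
    cycle⁺ (isCycle {x} {y} {z} {zs} distinct path) =
      isCycle (Unique.map⁺ (Injection.injective (↔⇒↣ e)) distinct)
              (subst (Linked _~_) (map-++ (to e) (x ∷ y ∷ z ∷ zs) (x ∷ []))
                     (Linked.map⁺ path))

-- Induction on `n`, splitting off the first summand. It serves to number the nodes of all the
-- snapshot decompositions together.
Σ-finite : ∀ n (o : Fin n → ℕ) → ∃[ m ] (Fin m ↔ Σ (Fin n) (Fin ∘ o))
Σ-finite ℕ.zero    o = 0 , mk↔ₛ′ (λ ()) (λ ()) (λ ()) (λ ())
Σ-finite (ℕ.suc n) o with Σ-finite n (o ∘ suc)
... | m , e = o zero ℕ.+ m , Σ-suc ↔-∘ ((↔-id _ ⊎-↔ e) ↔-∘ +↔⊎)
  where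
  Σ-suc : (Fin (o zero) ⊎ Σ (Fin n) (Fin ∘ o ∘ suc)) ↔ Σ (Fin (ℕ.suc n)) (Fin ∘ o)
  Σ-suc = mk↔ₛ′
    (λ { (inj₁ x) → zero , x ; (inj₂ (i , x)) → suc i , x })
    (λ { (zero , x) → inj₁ x ; (suc i , x) → inj₂ (i , x) })
    (λ { (zero , x) → refl ; (suc i , x) → refl })
    (λ { (inj₁ x) → refl ; (inj₂ (i , x)) → refl })

-- Joining trees at a new root

module Join {I : Set} {N : I → Set} {F : ∀ i → Graph (N i)} (F-tree : ∀ i → IsTree (F i)) where

  Node : Set
  Node = ⊤ ⊎ Σ I N

  pattern root     = inj₁ tt
  pattern node i x = inj₂ (i , x)

  -- The attachment point may be any node of the branch; `someVertex` supplies one because trees are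
  -- nonempty.
  top : ∀ i → N i
  top i = IsTree.someVertex (F-tree i)

  data _~_ : Rel Node 0ℓ where
    down  : ∀ i → root ~ node i (top i)
    up    : ∀ i → node i (top i) ~ root
    inner : ∀ {i x y} → Graph._~_ (F i) x y → node i x ~ node i y

  ~-sym : ∀ {x y} → x ~ y → y ~ x
  ~-sym (down i)      = up i
  ~-sym (up i)        = down i
  ~-sym (inner {i} e) = inner (Graph.~-sym (F i) e)

  join : Graph Node
  join = record
    { _~_      = _~_
    ; ~-sym    = ~-sym
    ; ~-irrefl = λ { refl (inner {i} e) → Graph.~-irrefl (F i) refl e }
    }

  join-connected : Connected join
  join-connected x y = toRoot x ◅◅ reverse ~-sym (toRoot y)
    where
    toRoot : ∀ x → Star _~_ x root
    toRoot root       = ε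
    toRoot (node i x) = gmap (node i) inner (IsTree.connected (F-tree i) x (top i)) ◅◅ up i ◅ ε

  InBranch : I → Node → Set
  InBranch i w = ∃[ x ] w ≡ node i x

  -- The only edges that leave a branch end at the root. The suffix `vs` leaves room for the vertex
  -- that closes a cycle, which may be the root.
  stays-in-branch : ∀ {i x} ws {vs} → All (root ≢_) ws →
                    Linked _~_ (node i x ∷ ws ++ vs) → All (InBranch i) ws
  stays-in-branch []       []          _                 = []
  stays-in-branch (_ ∷ _)  (≢root ∷ _) (up _    ∷ _)     = ⊥-elim (≢root refl)
  stays-in-branch (_ ∷ ws) (_ ∷ ≢root) (inner _ ∷ path) =
    (_ , refl) ∷ stays-in-branch ws ≢root path

  branch-nodes : ∀ {i ws} → All (InBranch i) ws → ∃[ xs ] ws ≡ map (node i) xs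
  branch-nodes []                   = [] , refl
  branch-nodes ((x , refl) ∷ inside) with branch-nodes inside
  ... | xs , refl = x ∷ xs , refl

  -- The neighbours of the root on the cycle are both the top of one branch.
  no-cycle-at-root : ∀ {ws} → ¬ IsCycle join (root ∷ ws)
  no-cycle-at-root (isCycle {z = z} {zs = zs} ((_ ∷ ≢root) ∷ (top≢ ∷ _)) (down i ∷ path))
    with penultimate {G = join} (Linked.tail path)
  ... | _ , w∈ , up j with All.lookup (stays-in-branch (z ∷ zs) ≢root path) w∈
  ... | _ , refl = All.lookup top≢ w∈ refl

  -- Such a cycle stays in the branch of its first node, so it is the image under `node i` of a
  -- cycle in the tree `F i`.
  no-cycle-off-root : ∀ {c} → All (root ≢_) c → ¬ IsCycle join c
  no-cycle-off-root (≢root ∷ _) (isCycle {x = root} _ _) = ≢root refl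
  no-cycle-off-root (_ ∷ ≢root) (isCycle {x = node i x} {y} {z} {zs} distinct path)
    with stays-in-branch (y ∷ z ∷ zs) ≢root path
  ... | (y′ , refl) ∷ (z′ , refl) ∷ inside with branch-nodes inside
  ... | zs′ , refl =
    IsTree.acyclic (F-tree i) (x ∷ y′ ∷ z′ ∷ zs′) (isCycle (Unique.map⁻ distinct)
      (Linked.map inner⁻ (Linked.map⁻
        (subst (Linked _~_) (sym (map-++ (node i) (x ∷ y′ ∷ z′ ∷ zs′) (x ∷ []))) path))))
    where
    inner⁻ : ∀ {x y} → node i x ~ node i y → Graph._~_ (F i) x y
    inner⁻ (inner e) = e

  join-acyclic : Acyclic join
  join-acyclic c cycle with any? root≟ c
    where
    root≟ : ∀ w → Dec (root ≡ w)
    root≟ root       = yes refl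
    root≟ (node _ _) = no λ ()
  ... | no root∉c  = no-cycle-off-root (All.¬Any⇒All¬ c root∉c) cycle
  -- Cutting the cycle at the root and rotating makes it start there.
  ... | yes root∈c with ∈-∃++ root∈c
  ... | xs , _ , refl = no-cycle-at-root (rotate xs cycle)

  join-isTree : IsTree join
  join-isTree = record { someVertex = root ; connected = join-connected ; acyclic = join-acyclic }

-- Width

module _ {V : Set} {G : Graph V} (D : TreeDecomposition G) where
  open TreeDecomposition D

  bag-length≤ : ∀ {k} → width ≤ k → ∀ i → + length (bag i) ≤ k + 1ℤ
  bag-length≤ {k} width≤k i = begin
    + length (bag i)               ≤⟨ +≤+ (All.lookup (xs≤max 0 lengths) length∈) ⟩
    + max 0 lengths                ≡⟨ ℤ.+-identityʳ _ ⟨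
    + max 0 lengths + (-1ℤ + 1ℤ)   ≡⟨ ℤ.+-assoc (+ max 0 lengths) -1ℤ 1ℤ ⟨
    width + 1ℤ                     ≤⟨ ℤ.+-monoˡ-≤ 1ℤ width≤k ⟩
    k + 1ℤ                         ∎
    where
    open ℤ.≤-Reasoning
    lengths = map (length ∘ bag) (allFin order)
    length∈ = ∈-map⁺ (length ∘ bag) (∈-allFin i)

  -- The maximum in `width` starts from the default 0, which contributes the bound `-1ℤ ≤ k` beside
  -- those of the bags.
  width≤ : ∀ {k} → -1ℤ ≤ k → (∀ i → + length (bag i) - 1ℤ ≤ k) → width ≤ k
  width≤ {k} -1≤k bags≤k =
    argmax-all (λ n → n) {P = λ n → + n - 1ℤ ≤ k} -1≤k
      (All.map⁺ (All.universal bags≤k (allFin order)))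

-- Tree decomposition of the Gaifman graph

module Decomposition (G : DynamicGraph) (D : ∀ t → TreeDecomposition (underlying (snapshot G t))) where
  open DynamicGraph G
  open TreeDecomposition
  open Join (λ t → isTree (D t))

  U : Set
  U = 𝒜-Universe G

  element : ∀ {t} → (Σ[ v ∈ V ] t ∈ₛ ζᵥ v) → U
  element {t} (v , p) = vertex v t p

  nodeBag : Node → List U
  nodeBag root       = map time (allFin ∣T∣)
  nodeBag (node t i) = time t ∷ map element (bag (D t) i)

  nodeBag-unique : ∀ x → Unique (nodeBag x)
  nodeBag-unique root       = Unique.map⁺ (λ { refl → refl }) (Unique.allFin⁺ ∣T∣)
  nodeBag-unique (node t i) =
    All.map⁺ (All.universal (λ _ ()) _) ∷
    Unique.map⁺ (λ { refl → refl }) (unique (D t) i)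

  time∈root : ∀ t → time t ∈ nodeBag root
  time∈root t = ∈-map⁺ time (∈-allFin t)

  vertex∈ : ∀ {t v p i} → (v , p) ∈ bag (D t) i → vertex v t p ∈ nodeBag (node t i)
  vertex∈ vp∈ = there (∈-map⁺ element vp∈)

  -- The element carries its time, which fixes the branch. The equation is returned so that matching
  -- it with `refl` puts two nodes containing the element into the same branch.
  vertex∈⁻ : ∀ {s t v p i} → vertex v t p ∈ nodeBag (node s i) →
             Σ[ eq ∈ s ≡ t ] (v , p) ∈ bag (D t) (subst (Fin ∘ order ∘ D) eq i)
  vertex∈⁻ (there vp∈) with ∈-map⁻ element vp∈
  ... | _ , vp∈ , refl = refl , vp∈

  vertex∉root : ∀ {t v p} → ¬ (vertex v t p ∈ nodeBag root)
  vertex∉root vp∈ with ∈-map⁻ time vp∈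
  ... | _ , _ , ()

  -- Placing whole tuples in one bag settles all pairs at once. For Ξ, a bag of `D t` covering the
  -- snapshot edge works, since `time t` was added to it.
  tuple⊆bag : ∀ s xs → 𝒜-Holds G s xs → ∃[ x ] Allᵥ (_∈ nodeBag x) xs
  tuple⊆bag _ _ (V-holds {v} {t} p) with coversVertices (D t) (v , p)
  ... | i , vp∈ = node t i , vertex∈ vp∈ ∷ []
  tuple⊆bag _ _ (L-holds {v} {t} p) with coversVertices (D t) (v , p)
  ... | i , vp∈ = node t i , vertex∈ vp∈ ∷ []
  tuple⊆bag _ _ (Ξ-holds {u} {v} {t} p q uv t∈) with coversEdges (D t) {u , p} {v , q} (inj₁ (uv , t∈))
  ... | i , up∈ , vq∈ = node t i , vertex∈ up∈ ∷ vertex∈ vq∈ ∷ here refl ∷ []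
  tuple⊆bag _ _ (T-holds t)           = root , time∈root t ∷ []
  tuple⊆bag _ _ (R-holds {s} {t} _) = root , time∈root s ∷ time∈root t ∷ []

  nodes-coverVertices : ∀ a → ∃[ x ] a ∈ nodeBag x
  nodes-coverVertices (vertex v t p) with coversVertices (D t) (v , p)
  ... | i , vp∈ = node t i , vertex∈ vp∈
  nodes-coverVertices (time t) = root , time∈root t

  nodes-coverEdges : ∀ {a b} → CoOccur (𝒜 G) a b → ∃[ x ] (a ∈ nodeBag x × b ∈ nodeBag x)
  nodes-coverEdges (s , xs , holds , a∈ , b∈) with tuple⊆bag s xs holds
  ... | x , ⊆bag = x , Allᵥ.lookup ⊆bag a∈ , Allᵥ.lookup ⊆bag b∈

  NodeAdjacent∋ : U → Rel Node 0ℓ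
  NodeAdjacent∋ a x y = a ∈ nodeBag x × a ∈ nodeBag y × x ~ y

  NodeAdjacent∋-sym : ∀ {a x y} → NodeAdjacent∋ a x y → NodeAdjacent∋ a y x
  NodeAdjacent∋-sym (a∈x , a∈y , x~y) = a∈y , a∈x , ~-sym x~y

  -- Away from the root, `time t` lies only in branch `t`, and there in every bag, so any path to
  -- the top of that branch extends to the root.
  time-toRoot : ∀ {t} x → time t ∈ nodeBag x → Star (NodeAdjacent∋ (time t)) x root
  time-toRoot root       _ = ε
  time-toRoot (node t i) (there t∈) with ∈-map⁻ element t∈
  ... | _ , _ , ()
  time-toRoot (node t i) (here refl) =
    gmap (node t) (λ e → here refl , here refl , inner e)
         (IsTree.connected (isTree (D t)) i (top t))
    ◅◅ (here refl , time∈root t , up t) ◅ ε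

  -- Time elements are linked through the root; a vertex element stays in one branch, where the
  -- connectedness of `D t` applies.
  nodes-connected : ∀ a {x y} → a ∈ nodeBag x → a ∈ nodeBag y → Star (NodeAdjacent∋ a) x y
  nodes-connected (time t) {x} {y} t∈x t∈y =
    time-toRoot x t∈x ◅◅ reverse NodeAdjacent∋-sym (time-toRoot y t∈y)
  nodes-connected (vertex v t p) {root}     {_}        vp∈ _   = ⊥-elim (vertex∉root vp∈)
  nodes-connected (vertex v t p) {node _ _} {root}     _   vp∈ = ⊥-elim (vertex∉root vp∈)
  nodes-connected (vertex v t p) {node _ _} {node _ _} a∈x a∈y
    with vertex∈⁻ a∈x | vertex∈⁻ a∈y
  ... | refl , vp∈i | refl , vp∈j =
    gmap (node t) (λ (∈i , ∈j , e) → vertex∈ ∈i , vertex∈ ∈j , inner e)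
         (connected (D t) (v , p) vp∈i vp∈j)

  nodes : ∃[ m ] (Fin m ↔ Node)
  nodes with Σ-finite ∣T∣ (order ∘ D)
  -- The additional index is the root.
  ... | m , e = ℕ.suc m , (1↔⊤ ⊎-↔ e) ↔-∘ +↔⊎

  enum : Fin (proj₁ nodes) ↔ Node
  enum = proj₂ nodes

  at-index : ∀ {P : Node → Set} → ∃ P → ∃ (P ∘ to enum)
  at-index {P} (x , px) = from enum x , subst P (sym (strictlyInverseˡ enum x)) px

  decomposition : TreeDecomposition (gaifman (𝒜 G))
  decomposition = record
    { order          = proj₁ nodes
    ; tree           = comap (to enum) join
    ; isTree         = comap-isTree enum join-isTree
    ; bag            = nodeBag ∘ to enum
    ; unique         = nodeBag-unique ∘ to enum
    ; coversVertices = at-index ∘ nodes-coverVertices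
    ; coversEdges    = λ (_ , co) → at-index (nodes-coverEdges co)
    ; connected      = λ a a∈x a∈y → Star-comap enum (nodes-connected a a∈x a∈y)
    }

  width-decomposition≤ : ∀ k → (∀ t → width (D t) ≤ k) →
                         width decomposition ≤ (k + 1ℤ) ⊔ (+ ∣T∣ - 1ℤ)
  width-decomposition≤ k widths≤k =
    width≤ decomposition
      -- The default bound: -1 is at most `+ ∣T∣ - 1ℤ` because `∣T∣` is a natural number, whatever
      -- the sign of `k`.
      (ℤ.≤-trans (ℤ.+-monoˡ-≤ -1ℤ (+≤+ (z≤n {∣T∣}))) (ℤ.i≤j⊔i (k + 1ℤ) (+ ∣T∣ - 1ℤ)))
      (nodeBag≤ ∘ to enum)
    where
    open ℤ.≤-Reasoning

    length-root : length (nodeBag root) ≡ ∣T∣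
    length-root = trans (length-map time (allFin ∣T∣)) (length-tabulate (λ (t : T) → t))

    nodeBag≤ : ∀ x → + length (nodeBag x) - 1ℤ ≤ (k + 1ℤ) ⊔ (+ ∣T∣ - 1ℤ)
    nodeBag≤ root = begin
      + length (nodeBag root) - 1ℤ    ≡⟨ cong (λ n → + n - 1ℤ) length-root ⟩
      + ∣T∣ - 1ℤ                      ≤⟨ ℤ.i≤j⊔i (k + 1ℤ) _ ⟩
      (k + 1ℤ) ⊔ (+ ∣T∣ - 1ℤ)         ∎
    nodeBag≤ (node t i) = begin
      -- The 1 subtracted in the width cancels `time t` by computation, leaving the size of the
      -- snapshot bag, at most `k + 1ℤ`.
      + length (map element (bag (D t) i)) ≡⟨ cong +_ (length-map element (bag (D t) i)) ⟩
      + length (bag (D t) i)               ≤⟨ bag-length≤ (D t) (widths≤k t) i ⟩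
      k + 1ℤ                               ≤⟨ ℤ.i≤i⊔j (k + 1ℤ) _ ⟩
      (k + 1ℤ) ⊔ (+ ∣T∣ - 1ℤ)              ∎

theorem4 : (G : DynamicGraph) (k : ℤ) →
    (∀ t → tw[ underlying (snapshot G t) ]≤ k) →
    tw[ gaifman (𝒜 G) ]≤ ((k + 1ℤ) ⊔ (+ DynamicGraph.∣T∣ G - 1ℤ))
theorem4 G k D = decomposition , width-decomposition≤ k (proj₂ ∘ D)
  where open Decomposition G (proj₁ ∘ D)
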